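{- For every sequent $\Gamma\Rightarrow\delta$ of first-order arithmetic: if $\mathrm{CHA}\vdash\Gamma\Rightarrow\delta$ then $\mathrm{SHA}\vdash\Gamma\Rightarrow\delta$.
   Context: Language: terms from variables, $0,S,+,\cdot$; formulas from $s=t,\bot,\wedge,\vee,\to,\forall,\exists$. $\mathrm{HA}$-sequents $\Gamma\Rightarrow\delta$: finite set $\Gamma$, single formula $\delta$. $\mathrm{CHA}$: sequent calculus with the standard intuitionistic rules Ax ($\Gamma,\delta\Rightarrow\delta$), $\to$L/R, $\wedge$L/R, $\vee$L/R, $\forall$L/R, $\exists$L/R (usual eigenvariable conditions), $\bot$L, $=$L (from $\Gamma[x/y]\Rightarrow\delta[x/y]$ infer $\Gamma[s/x,t/y],s=t\Rightarrow\delta[s/x,t/y]$, $x,y\notin\mathrm{FV}(s,t)$), $=$R ($\Gamma\Rightarrow t=t$), weakening, cut, arithmetic axioms $\Rightarrow 0\neq St$, $Ss=St\Rightarrow s=t$, $\Rightarrow s+0=s$, $\Rightarrow s+St=S(s+t)$, $\Rightarrow s\cdot0=0$, $\Rightarrow s\cdot St=(s\cdot t)+s$, and $\textsc{Case}_x$ (from $\Gamma[0/x]\Rightarrow\delta[0/x]$ and $\Gamma[Sx/x]\Rightarrow\delta[Sx/x]$ infer $\Gamma\Rightarrow\delta$). Pre-proofs are finite trees with a partial map $\beta$ from some leaves (buds) to inner nodes (companions); non-bud nodes carry rule instances whose premises label the children; buds carry their companion's sequent. Infinite branches start at the root and step to a child or from a bud to its companion. A $\mathrm{CHA}$-proof is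 a pre-proof such that along every infinite branch some variable $x$ is, from some point on, free in every sequent and the branch passes instances of $\textsc{Case}_x$ infinitely often. $\mathrm{SHA}$ (stack-labelled Heyting arithmetic): a companion label is $x^\bullet\mapsto\Gamma\Rightarrow\delta$ with $\Gamma\Rightarrow\delta$ an $\mathrm{HA}$-sequent, $x\in\mathrm{FV}(\Gamma,\delta)$, $x^\bullet\in\{x^+,x^-\}$. A stack $\Lambda$ is a finite list of labels (written $\Lambda;\ell$ when $\ell$ is appended last), $\varepsilon$ the empty list, $\textsc{Var}(\Lambda)$ the set of variables of its labels. $\Lambda^{+x}$ replaces every $x^-$ in $\Lambda$ by $x^+$. $\mathrm{SHA}$-sequents are $\Lambda\mid\Gamma\Rightarrow\delta$; such a sequent is well-formed if every variable in $\textsc{Var}(\Lambda)$ is free in $\Gamma,\delta$. Rules: (i) every logical rule of $\mathrm{HA}$ listed above (including weakening, cut, $=$L, $=$R, $\bot$L) with the same stack $\Lambda$ in conclusion and all premises, where the eigenvariable of $\forall$R/$\exists$L must also not occur in $\Lambda$; (ii) Ax and the arithmetic axioms only with empty stack, e.g. $\varepsilon\mid\Gamma,\delta\Rightarrow\delta$, $\varepsilon\mid\Gamma\Rightarrow 0\neq St$, $\varepsilon\mid\Gamma,Ss=St\Rightarrow s=t$, etc.; (iii) label rules: Comp (from $\Lambda;(x^-\mapsto\Gamma\Rightarrow\delta)\mid\Gamma\Rightarrow\delta$ infer $\Lambda\mid\Gamma\Rightarrow\delta$), Bud (axiom $\Lambda;(x^+\mapsto\Gamma\Rightarrow\delta)\mid\Gamma\Rightarrow\delta$),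 Pop (from $\Lambda\mid\Gamma\Rightarrow\delta$ infer $\Lambda;\Lambda'\mid\Gamma\Rightarrow\delta$), $\textsc{Case}_x$ (from $\Lambda\mid\Gamma[0/x]\Rightarrow\delta[0/x]$ and $\Lambda^{+x}\mid\Gamma[Sx/x]\Rightarrow\delta[Sx/x]$ infer $\Lambda\mid\Gamma\Rightarrow\delta$). $\mathrm{SHA}$-proofs are finite (non-cyclic) trees; every rule except Pop may only derive well-formed sequents. $\mathrm{SHA}\vdash\Gamma\Rightarrow\delta$ means there is an $\mathrm{SHA}$-proof of $\varepsilon\mid\Gamma\Rightarrow\delta$. -}

module Defs where

open import Data.Nat using (ℕ; zero; suc; _≤_; _<_; _<?_)
open import Data.Nat.Properties using (_≟_)
open import Data.Fin using (Fin; zero; suc; fromℕ<)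
open import Data.List using (List; []; _∷_; map; _++_; _∷ʳ_; length; lookup)
open import Data.List.Membership.Propositional using (_∈_)
open import Data.List.Relation.Unary.All using (All)
open import Data.List.Relation.Unary.Any using (Any)
open import Data.List.Relation.Binary.Pointwise using (Pointwise)
open import Data.Maybe using (Maybe; just; nothing)
open import Data.Product using (Σ; _×_; _,_; ∃)
open import Data.Sum using (_⊎_)
open import Data.Empty using (⊥)
open import Data.Unit using (⊤)
open import Data.Bool using (Bool; true; false; if_then_else_)
open import Relation.Nullary using (¬_; yes; no; does)
open import Relation.Binary.PropositionalEquality using (_≡_; _≢_)

-- Syntax of first-order arithmetic (locally nameless).
-- Free variables are named by natural numbers (fv x); bound variables are
-- de Bruijn indices (bv i : Fin n, n = number of enclosing binders).
-- Formulas of type Fm 0 are exactly the (locally closed) formulas.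

data Tm (n : ℕ) : Set where
  fv   : ℕ → Tm n
  bv   : Fin n → Tm n
  `0   : Tm n
  `S   : Tm n → Tm n
  _`+_ : Tm n → Tm n → Tm n
  _`·_ : Tm n → Tm n → Tm n

data Fm (n : ℕ) : Set where
  _≐_  : Tm n → Tm n → Fm n
  `⊥   : Fm n
  _`∧_ : Fm n → Fm n → Fm n
  _`∨_ : Fm n → Fm n → Fm n
  _`→_ : Fm n → Fm n → Fm n
  `∀   : Fm (suc n) → Fm n
  `∃   : Fm (suc n) → Fm n

_≠_ : ∀ {n} → Tm n → Tm n → Fm n
s ≠ t = (s ≐ t) `→ `⊥

wk : ∀ {n} → Tm 0 → Tm n
wk (fv x)   = fv x
wk (bv ())
wk `0       = `0
wk (`S t)   = `S (wk t)
wk (s `+ t) = wk s `+ wk t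
wk (s `· t) = wk s `· wk t

shiftT : ∀ {n} → Tm n → Tm (suc n)
shiftT (fv x)   = fv x
shiftT (bv i)   = bv (suc i)
shiftT `0       = `0
shiftT (`S t)   = `S (shiftT t)
shiftT (s `+ t) = shiftT s `+ shiftT t
shiftT (s `· t) = shiftT s `· shiftT t

liftB : ∀ {m k} → (Fin m → Tm k) → Fin (suc m) → Tm (suc k)
liftB σ zero    = bv zero
liftB σ (suc i) = shiftT (σ i)

bsubT : ∀ {m k} → (Fin m → Tm k) → Tm m → Tm k
bsubT σ (fv x)   = fv x
bsubT σ (bv i)   = σ i
bsubT σ `0       = `0
bsubT σ (`S t)   = `S (bsubT σ t)
bsubT σ (s `+ t) = bsubT σ s `+ bsubT σ t
bsubT σ (s `· t) = bsubT σ s `· bsubT σ t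

bsubF : ∀ {m k} → (Fin m → Tm k) → Fm m → Fm k
bsubF σ (s ≐ t)  = bsubT σ s ≐ bsubT σ t
bsubF σ `⊥       = `⊥
bsubF σ (φ `∧ ψ) = bsubF σ φ `∧ bsubF σ ψ
bsubF σ (φ `∨ ψ) = bsubF σ φ `∨ bsubF σ ψ
bsubF σ (φ `→ ψ) = bsubF σ φ `→ bsubF σ ψ
bsubF σ (`∀ φ)   = `∀ (bsubF (liftB σ) φ)
bsubF σ (`∃ φ)   = `∃ (bsubF (liftB σ) φ)

inst : ∀ {n} → Fm (suc n) → Tm 0 → Fm n
inst φ t = bsubF (λ { zero → wk t ; (suc i) → bv i }) φ

fsubT : ∀ {n} → (ℕ → Tm 0) → Tm n → Tm n
fsubT σ (fv x)   = wk (σ x)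
fsubT σ (bv i)   = bv i
fsubT σ `0       = `0
fsubT σ (`S t)   = `S (fsubT σ t)
fsubT σ (s `+ t) = fsubT σ s `+ fsubT σ t
fsubT σ (s `· t) = fsubT σ s `· fsubT σ t

fsubF : ∀ {n} → (ℕ → Tm 0) → Fm n → Fm n
fsubF σ (s ≐ t)  = fsubT σ s ≐ fsubT σ t
fsubF σ `⊥       = `⊥
fsubF σ (φ `∧ ψ) = fsubF σ φ `∧ fsubF σ ψ
fsubF σ (φ `∨ ψ) = fsubF σ φ `∨ fsubF σ ψ
fsubF σ (φ `→ ψ) = fsubF σ φ `→ fsubF σ ψ
fsubF σ (`∀ φ)   = `∀ (fsubF σ φ)
fsubF σ (`∃ φ)   = `∃ (fsubF σ φ)

[_/_] : Tm 0 → ℕ → ℕ → Tm 0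
[ t / x ] y = if does (y ≟ x) then t else fv y

[_/_,_/_] : Tm 0 → ℕ → Tm 0 → ℕ → ℕ → Tm 0
[ s / x , t / y ] z =
  if does (z ≟ x) then s else (if does (z ≟ y) then t else fv z)

FreeT : ∀ {n} → ℕ → Tm n → Set
FreeT x (fv y)   = x ≡ y
FreeT x (bv i)   = ⊥
FreeT x `0       = ⊥
FreeT x (`S t)   = FreeT x t
FreeT x (s `+ t) = FreeT x s ⊎ FreeT x t
FreeT x (s `· t) = FreeT x s ⊎ FreeT x t

FreeF : ∀ {n} → ℕ → Fm n → Set
FreeF x (s ≐ t)  = FreeT x s ⊎ FreeT x t
FreeF x `⊥       = ⊥
FreeF x (φ `∧ ψ) = FreeF x φ ⊎ FreeF x ψ
FreeF x (φ `∨ ψ) = FreeF x φ ⊎ FreeF x ψ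
FreeF x (φ `→ ψ) = FreeF x φ ⊎ FreeF x ψ
FreeF x (`∀ φ)   = FreeF x φ
FreeF x (`∃ φ)   = FreeF x φ

-- HA-sequents  Γ ⇒ δ.  The finite set Γ is represented by a list; lists are
-- identified up to having the same elements (see _≈_ and the instance
-- closures below), so that Γ really behaves as a finite set.

Ctx : Set
Ctx = List (Fm 0)

record Seq : Set where
  constructor _⇒_
  field
    ctx  : Ctx
    succ : Fm 0
open Seq public

infix 4 _⇒_

FreeS : ℕ → Seq → Set
FreeS x (Γ ⇒ δ) = Any (FreeF x) Γ ⊎ FreeF x δ

NotFreeS : ℕ → Seq → Set
NotFreeS x s = ¬ FreeS x s

subS : (ℕ → Tm 0) → Seq → Seq
subS σ (Γ ⇒ δ) = map (fsubF σ) Γ ⇒ fsubF σ δ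

_≈_ : Seq → Seq → Set
(Γ ⇒ δ) ≈ (Δ ⇒ ε) =
  ((φ : Fm 0) → φ ∈ Γ → φ ∈ Δ) × ((φ : Fm 0) → φ ∈ Δ → φ ∈ Γ) × δ ≡ ε

-- Logical rules of HA (shared by CHA and SHA), as templates on lists.
-- The parameter Fr is an extra freshness requirement on eigenvariables
-- (trivial for CHA; "does not occur in Λ" for SHA).
-- LRule Fr prems concl : premises and conclusion of an instance.

data LRule (Fr : ℕ → Set) : List Seq → Seq → Set where
  →L  : ∀ Γ φ ψ δ → LRule Fr ((Γ ⇒ φ) ∷ (ψ ∷ Γ ⇒ δ) ∷ []) ((φ `→ ψ) ∷ Γ ⇒ δ)
  →R  : ∀ Γ φ ψ → LRule Fr ((φ ∷ Γ ⇒ ψ) ∷ []) (Γ ⇒ φ `→ ψ)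
  ∧L  : ∀ Γ φ ψ δ → LRule Fr ((φ ∷ ψ ∷ Γ ⇒ δ) ∷ []) ((φ `∧ ψ) ∷ Γ ⇒ δ)
  ∧R  : ∀ Γ φ ψ → LRule Fr ((Γ ⇒ φ) ∷ (Γ ⇒ ψ) ∷ []) (Γ ⇒ φ `∧ ψ)
  ∨L  : ∀ Γ φ ψ δ → LRule Fr ((φ ∷ Γ ⇒ δ) ∷ (ψ ∷ Γ ⇒ δ) ∷ []) ((φ `∨ ψ) ∷ Γ ⇒ δ)
  ∨R₁ : ∀ Γ φ ψ → LRule Fr ((Γ ⇒ φ) ∷ []) (Γ ⇒ φ `∨ ψ)
  ∨R₂ : ∀ Γ φ ψ → LRule Fr ((Γ ⇒ ψ) ∷ []) (Γ ⇒ φ `∨ ψ)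
  ∀L  : ∀ Γ φ t δ → LRule Fr ((inst φ t ∷ Γ ⇒ δ) ∷ []) (`∀ φ ∷ Γ ⇒ δ)
  ∀R  : ∀ Γ φ a → NotFreeS a (Γ ⇒ `∀ φ) → Fr a →
        LRule Fr ((Γ ⇒ inst φ (fv a)) ∷ []) (Γ ⇒ `∀ φ)
  ∃L  : ∀ Γ φ a δ → NotFreeS a (`∃ φ ∷ Γ ⇒ δ) → Fr a →
        LRule Fr ((inst φ (fv a) ∷ Γ ⇒ δ) ∷ []) (`∃ φ ∷ Γ ⇒ δ)
  ∃R  : ∀ Γ φ t → LRule Fr ((Γ ⇒ inst φ t) ∷ []) (Γ ⇒ `∃ φ)
  ⊥L  : ∀ Γ δ → LRule Fr [] (`⊥ ∷ Γ ⇒ δ)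
  =L  : ∀ Γ δ x y s t → x ≢ y →
        ¬ FreeT x s → ¬ FreeT x t → ¬ FreeT y s → ¬ FreeT y t →
        LRule Fr (subS [ fv x / y ] (Γ ⇒ δ) ∷ [])
                 ((s ≐ t) ∷ ctx (subS [ s / x , t / y ] (Γ ⇒ δ))
                   ⇒ succ (subS [ s / x , t / y ] (Γ ⇒ δ)))
  =R  : ∀ Γ t → LRule Fr [] (Γ ⇒ t ≐ t)
  wkn : ∀ Γ φ δ → LRule Fr ((Γ ⇒ δ) ∷ []) (φ ∷ Γ ⇒ δ)
  cut : ∀ Γ φ δ → LRule Fr ((Γ ⇒ φ) ∷ (φ ∷ Γ ⇒ δ) ∷ []) (Γ ⇒ δ)

data AxCtx : Seq → Set where
  ax    : ∀ Γ δ → AxCtx (δ ∷ Γ ⇒ δ)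
  zS    : ∀ Γ t → AxCtx (Γ ⇒ `0 ≠ `S t)
  SS    : ∀ Γ s t → AxCtx ((`S s ≐ `S t) ∷ Γ ⇒ s ≐ t)
  plus0 : ∀ Γ s → AxCtx (Γ ⇒ (s `+ `0) ≐ s)
  plusS : ∀ Γ s t → AxCtx (Γ ⇒ (s `+ `S t) ≐ `S (s `+ t))
  mul0  : ∀ Γ s → AxCtx (Γ ⇒ (s `· `0) ≐ `0)
  mulS  : ∀ Γ s t → AxCtx (Γ ⇒ (s `· `S t) ≐ ((s `· t) `+ s))

data AxCHA : Seq → Set where
  ax    : ∀ Γ δ → AxCHA (δ ∷ Γ ⇒ δ)
  zS    : ∀ t → AxCHA ([] ⇒ `0 ≠ `S t)
  SS    : ∀ s t → AxCHA ((`S s ≐ `S t) ∷ [] ⇒ s ≐ t)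
  plus0 : ∀ s → AxCHA ([] ⇒ (s `+ `0) ≐ s)
  plusS : ∀ s t → AxCHA ([] ⇒ (s `+ `S t) ≐ `S (s `+ t))
  mul0  : ∀ s → AxCHA ([] ⇒ (s `· `0) ≐ `0)
  mulS  : ∀ s t → AxCHA ([] ⇒ (s `· `S t) ≐ ((s `· t) `+ s))

case0 : ℕ → Seq → Seq
case0 x s = subS [ `0 / x ] s

caseS : ℕ → Seq → Seq
caseS x s = subS [ `S (fv x) / x ] s

data CHARule : List Seq → Seq → Set where
  logic : ∀ {ss s} → LRule (λ _ → ⊤) ss s → CHARule ss s
  axiom : ∀ {s} → AxCHA s → CHARule [] s
  case  : ∀ x s → CHARule (case0 x s ∷ caseS x s ∷ []) s

CHAInst : List Seq → Seq → Set
CHAInst ss s = Σ (List Seq) λ ss' → Σ Seq λ s' →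
  CHARule ss' s' × Pointwise _≈_ ss ss' × s ≈ s'

caseVar : ∀ {ss s} → CHAInst ss s → Maybe ℕ
caseVar (_ , _ , case x _ , _) = just x
caseVar _                     = nothing

-- Pre-proofs: finite trees; a bud carries a sequent and the address of
-- its companion (the partial map β); other nodes carry a rule instance
-- whose premises label the children.
Addr : Set
Addr = List ℕ   -- path of child positions from the root

data PreTree : Seq → Set where
  bud  : ∀ {s} → Addr → PreTree s
  node : ∀ {s} (ss : List Seq) → CHAInst ss s →
         ((i : Fin (length ss)) → PreTree (lookup ss i)) → PreTree s

data Info : Set where
  budI  : Seq → Addr → Info
  nodeI : (s : Seq) (ss : List Seq) → CHAInst ss s → Info

infoSeq : Info → Seq
infoSeq (budI s _)     = s
infoSeq (nodeI s _ _)  = s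

look : ∀ {s} → PreTree s → Addr → Maybe Info
look {s} (bud c)       []      = just (budI s c)
look {s} (node ss r f) []      = just (nodeI s ss r)
look (bud c)           (i ∷ p) = nothing
look (node ss r f)     (i ∷ p) with i <? length ss
... | yes h = look (f (fromℕ< h)) p
... | no _  = nothing

IsPreProof : ∀ {s} → PreTree s → Set
IsPreProof t = ∀ p s c → look t p ≡ just (budI s c) →
  Σ Seq λ s' → Σ (List Seq) λ ss → Σ (CHAInst ss s') λ r →
    look t c ≡ just (nodeI s' ss r) × 1 ≤ length ss × s' ≈ s

data Step {s} (t : PreTree s) : Addr → Addr → Set where
  child : ∀ {p s' ss r} i → look t p ≡ just (nodeI s' ss r) →
          i < length ss → Step t p (p ++ i ∷ [])
  jump  : ∀ {p s' c} → look t p ≡ just (budI s' c) → Step t p c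

record InfBranch {s} (t : PreTree s) : Set where
  field
    pos   : ℕ → Addr
    start : pos 0 ≡ []
    steps : ∀ k → Step t (pos k) (pos (suc k))
open InfBranch public

FreeAt : ∀ {s} → PreTree s → ℕ → Addr → Set
FreeAt t x p = Σ Info λ i → look t p ≡ just i × FreeS x (infoSeq i)

CaseAt : ∀ {s} → PreTree s → ℕ → Addr → Set
CaseAt t x p = Σ Seq λ s' → Σ (List Seq) λ ss → Σ (CHAInst ss s') λ r →
  look t p ≡ just (nodeI s' ss r) × caseVar r ≡ just x

GoodBranch : ∀ {s} {t : PreTree s} → InfBranch t → Set
GoodBranch {t = t} b = Σ ℕ λ x → Σ ℕ λ N →
  (∀ k → N ≤ k → FreeAt t x (pos b k)) ×
  (∀ M → Σ ℕ λ k → M ≤ k × CaseAt t x (pos b k))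

CHA⊢ : Seq → Set
CHA⊢ s = Σ (PreTree s) λ t → IsPreProof t × ((b : InfBranch t) → GoodBranch b)

data Sign : Set where
  plus minus : Sign

record Label : Set where
  constructor lab
  field
    sign : Sign
    var  : ℕ
    lseq : Seq
open Label public

Stack : Set
Stack = List Label

raise : ℕ → Label → Label
raise x (lab minus y s) = if does (y ≟ x) then lab plus y s else lab minus y s
raise x (lab plus y s)  = lab plus y s

_⁺_ : Stack → ℕ → Stack
Λ ⁺ x = map (raise x) Λ

WF : Stack → Seq → Set
WF Λ s = All (λ l → FreeS (var l) s) Λ

OccursΛ : ℕ → Stack → Set
OccursΛ a Λ = Any (λ l → a ≡ var l ⊎ FreeS a (lseq l)) Λ

LInst : (ℕ → Set) → List Seq → Seq → Set
LInst Fr ss s = Σ (List Seq) λ ss' → Σ Seq λ s' →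
  LRule Fr ss' s' × Pointwise _≈_ ss ss' × s ≈ s'

data SHA⊢_∣_ : Stack → Seq → Set where
  logic : ∀ {Λ ss s} → LInst (λ a → ¬ OccursΛ a Λ) ss s → WF Λ s →
          All (SHA⊢_∣_ Λ) ss → SHA⊢ Λ ∣ s
  axiom : ∀ {s s'} → AxCtx s' → s ≈ s' → SHA⊢ [] ∣ s
  comp  : ∀ {Λ s} x → FreeS x s → WF Λ s →
          SHA⊢ (Λ ∷ʳ lab minus x s) ∣ s → SHA⊢ Λ ∣ s
  bud   : ∀ {Λ s s'} x → FreeS x s' → s' ≈ s →
          WF (Λ ∷ʳ lab plus x s') s → SHA⊢ (Λ ∷ʳ lab plus x s') ∣ s
  pop   : ∀ {Λ s} Λ' → SHA⊢ Λ ∣ s → SHA⊢ (Λ ++ Λ') ∣ s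
  case  : ∀ {Λ s} x → WF Λ s →
          SHA⊢ Λ ∣ case0 x s → SHA⊢ (Λ ⁺ x) ∣ caseS x s → SHA⊢ Λ ∣ s

SHA⊢ : Seq → Set
SHA⊢ s = SHA⊢ [] ∣ s

{-# OPTIONS --safe #-}
-- A CHA-proof is a finite graph.  In a strongly connected set S of its nodes some x is free everywhere
-- and Case_x occurs: walk infinitely often through all of S.  S is unfolded into SHA by pushing a label
-- for x at the node of entry and recursing into S without its Case_x nodes; passing Case_x raises all
-- labels pushed for S, so a return to a labelled node is a bud, and any other node is pushed as well,
-- which can happen only |S| times.  A set that is not strongly connected is split along reachability.
-- Steps out of S pop the labels pushed for S.
module Submission where

open import Defs
open import Data.Nat using (ℕ; zero; suc; _+_; _∸_; _⊔_; _≤_; _<_; _<?_; z≤n; s≤s; s≤s⁻¹)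
import Data.Nat.Properties as ℕ
open import Data.Nat.Properties
  using (_≟_; ≤-refl; ≤-trans; <⇒≢; <-irrefl; m≤m⊔n; m≤n⊔m; m≤n+m; +-mono-≤; m+[n∸m]≡n)
open import Data.Fin using (Fin; zero; suc; toℕ; fromℕ<)
open import Data.Fin.Properties using (fromℕ<-toℕ; toℕ<n; toℕ-fromℕ<)
open import Data.Bool using (true; false; if_then_else_)
open import Data.List
  using (List; []; _∷_; map; _++_; _∷ʳ_; length; filter; lookup; allFin; concatMap)
open import Data.List.Properties
  using (map-cong-local; map-id; map-++; ++-assoc; ++-identityʳ; ∷ʳ-++; filter-notAll; ≡-dec)
open import Data.List.Membership.Propositional using (_∈_; _∉_; find; lose)
open import Data.List.Membership.Propositional.Properties
  using (∈-filter⁺; ∈-filter⁻; ∈-map⁺; ∈-map⁻; ∈-∃++; ∈-++⁺ˡ; ∈-++⁺ʳ; ∈-allFin; ∈-concatMap⁺)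
import Data.List.Membership.DecPropositional as DecMembership
open import Data.List.Relation.Unary.All as All using (All; []; _∷_; all?)
import Data.List.Relation.Unary.All.Properties as All
open import Data.List.Relation.Unary.Any using (Any; here; there)
open import Data.List.Relation.Binary.Pointwise as Pointwise using (Pointwise; []; _∷_)
open import Data.Maybe using (Maybe; just; nothing)
import Data.Maybe.Properties as Maybe
open import Data.Product using (Σ; _×_; _,_; ∃; proj₁; proj₂)
open import Data.Sum using (_⊎_; inj₁; inj₂; [_,_]′) renaming (map to map-⊎)
open import Data.Unit using (⊤)
open import Function using (_∘_; id)
open import Relation.Nullary using (¬_; Dec; yes; no; does; contradiction)
open import Relation.Nullary.Decidable using (dec-true; dec-false; _⊎-dec_; _×-dec_; ¬?)
open import Relation.Binary using (DecidableEquality)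
open import Relation.Binary.Construct.Closure.ReflexiveTransitive using (Star; ε; _◅_)
open import Relation.Binary.PropositionalEquality
  using (_≡_; _≢_; refl; sym; trans; cong; cong₂; subst)

-- Free variables and substitution

-- The bound is itself a name outside `P`; fresh variables for sequents and stacks are chosen in
-- this way.
Bounded : (ℕ → Set) → Set
Bounded P = ∃ λ n → ∀ x → P x → x < n

bounded-≡ : ∀ y → Bounded (_≡ y)
bounded-≡ y = suc y , λ { _ refl → ≤-refl }

bounded-⊎ : ∀ {P Q} → Bounded P → Bounded Q → Bounded (λ x → P x ⊎ Q x)
bounded-⊎ (m , f) (n , g) = m ⊔ n , λ
  { x (inj₁ p) → ≤-trans (f x p) (m≤m⊔n m n)
  ; x (inj₂ q) → ≤-trans (g x q) (m≤n⊔m m n) }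

bounded-Any : ∀ {A : Set} {P : ℕ → A → Set} → (∀ a → Bounded (λ x → P x a)) →
              ∀ as → Bounded (λ x → Any (P x) as)
bounded-Any f []       = 0 , λ _ ()
bounded-Any f (a ∷ as) with bounded-⊎ (f a) (bounded-Any f as)
... | n , g = n , λ { x (here p) → g x (inj₁ p) ; x (there p) → g x (inj₂ p) }

boundedT : ∀ {n} (t : Tm n) → Bounded (λ x → FreeT x t)
boundedT (fv y)   = bounded-≡ y
boundedT (bv i)   = 0 , λ _ ()
boundedT `0       = 0 , λ _ ()
boundedT (`S t)   = boundedT t
boundedT (s `+ t) = bounded-⊎ (boundedT s) (boundedT t)
boundedT (s `· t) = bounded-⊎ (boundedT s) (boundedT t)

boundedF : ∀ {n} (φ : Fm n) → Bounded (λ x → FreeF x φ)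
boundedF (s ≐ t)  = bounded-⊎ (boundedT s) (boundedT t)
boundedF `⊥       = 0 , λ _ ()
boundedF (φ `∧ ψ) = bounded-⊎ (boundedF φ) (boundedF ψ)
boundedF (φ `∨ ψ) = bounded-⊎ (boundedF φ) (boundedF ψ)
boundedF (φ `→ ψ) = bounded-⊎ (boundedF φ) (boundedF ψ)
boundedF (`∀ φ)   = boundedF φ
boundedF (`∃ φ)   = boundedF φ

boundedS : ∀ s → Bounded (λ x → FreeS x s)
boundedS (Γ ⇒ δ) = bounded-⊎ (bounded-Any boundedF Γ) (boundedF δ)

boundedΛ : ∀ Λ → Bounded (λ x → OccursΛ x Λ)
boundedΛ = bounded-Any λ l → bounded-⊎ (bounded-≡ (var l)) (boundedS (lseq l))

fsubT-cong : ∀ {n σ τ} (t : Tm n) → (∀ x → FreeT x t → σ x ≡ τ x) →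
             fsubT σ t ≡ fsubT τ t
fsubT-cong (fv x)   e = cong wk (e x refl)
fsubT-cong (bv i)   e = refl
fsubT-cong `0       e = refl
fsubT-cong (`S t)   e = cong `S (fsubT-cong t e)
fsubT-cong (s `+ t) e =
  cong₂ _`+_ (fsubT-cong s λ x → e x ∘ inj₁) (fsubT-cong t λ x → e x ∘ inj₂)
fsubT-cong (s `· t) e =
  cong₂ _`·_ (fsubT-cong s λ x → e x ∘ inj₁) (fsubT-cong t λ x → e x ∘ inj₂)

fsubF-cong : ∀ {n σ τ} (φ : Fm n) → (∀ x → FreeF x φ → σ x ≡ τ x) →
             fsubF σ φ ≡ fsubF τ φ
fsubF-cong (s ≐ t)  e =
  cong₂ _≐_ (fsubT-cong s λ x → e x ∘ inj₁) (fsubT-cong t λ x → e x ∘ inj₂)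
fsubF-cong `⊥       e = refl
fsubF-cong (φ `∧ ψ) e =
  cong₂ _`∧_ (fsubF-cong φ λ x → e x ∘ inj₁) (fsubF-cong ψ λ x → e x ∘ inj₂)
fsubF-cong (φ `∨ ψ) e =
  cong₂ _`∨_ (fsubF-cong φ λ x → e x ∘ inj₁) (fsubF-cong ψ λ x → e x ∘ inj₂)
fsubF-cong (φ `→ ψ) e =
  cong₂ _`→_ (fsubF-cong φ λ x → e x ∘ inj₁) (fsubF-cong ψ λ x → e x ∘ inj₂)
fsubF-cong (`∀ φ)   e = cong `∀ (fsubF-cong φ e)
fsubF-cong (`∃ φ)   e = cong `∃ (fsubF-cong φ e)

fsubT-fv : ∀ {n} (t : Tm n) → fsubT fv t ≡ t
fsubT-fv (fv x)   = refl
fsubT-fv (bv i)   = refl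
fsubT-fv `0       = refl
fsubT-fv (`S t)   = cong `S (fsubT-fv t)
fsubT-fv (s `+ t) = cong₂ _`+_ (fsubT-fv s) (fsubT-fv t)
fsubT-fv (s `· t) = cong₂ _`·_ (fsubT-fv s) (fsubT-fv t)

fsubF-fv : ∀ {n} (φ : Fm n) → fsubF fv φ ≡ φ
fsubF-fv (s ≐ t)  = cong₂ _≐_ (fsubT-fv s) (fsubT-fv t)
fsubF-fv `⊥       = refl
fsubF-fv (φ `∧ ψ) = cong₂ _`∧_ (fsubF-fv φ) (fsubF-fv ψ)
fsubF-fv (φ `∨ ψ) = cong₂ _`∨_ (fsubF-fv φ) (fsubF-fv ψ)
fsubF-fv (φ `→ ψ) = cong₂ _`→_ (fsubF-fv φ) (fsubF-fv ψ)
fsubF-fv (`∀ φ)   = cong `∀ (fsubF-fv φ)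
fsubF-fv (`∃ φ)   = cong `∃ (fsubF-fv φ)

subS-cong : ∀ {σ τ} s → (∀ x → FreeS x s → σ x ≡ τ x) → subS σ s ≡ subS τ s
subS-cong (Γ ⇒ δ) e = cong₂ _⇒_
  (map-cong-local (All.tabulate λ {φ} m → fsubF-cong φ λ x f → e x (inj₁ (lose m f))))
  (fsubF-cong δ λ x → e x ∘ inj₂)

subS-fv : ∀ s → subS fv s ≡ s
subS-fv (Γ ⇒ δ) = cong₂ _⇒_
  (trans (map-cong-local (All.tabulate λ {φ} _ → fsubF-fv φ)) (map-id Γ)) (fsubF-fv δ)

subS-fixed : ∀ {σ} s → (∀ x → FreeS x s → σ x ≡ fv x) → subS σ s ≡ s
subS-fixed s e = trans (subS-cong s e) (subS-fv s)

/-same : ∀ t x → [ t / x ] x ≡ t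
/-same t x = cong (if_then t else fv x) (dec-true (x ≟ x) refl)

/-other : ∀ t {x y} → y ≢ x → [ t / x ] y ≡ fv y
/-other t {x} {y} y≢x = cong (if_then t else fv y) (dec-false (y ≟ x) y≢x)

//-other : ∀ s t {x y z} → z ≢ y → [ s / x , t / y ] z ≡ [ s / x ] z
//-other s t {x} {y} {z} z≢y =
  cong (λ b → if does (z ≟ x) then s else (if b then t else fv z)) (dec-false (z ≟ y) z≢y)

-- Substitution for free variables under binders

shiftT-wk : ∀ {n} (t : Tm 0) → shiftT {n} (wk t) ≡ wk t
shiftT-wk (fv x)   = refl
shiftT-wk `0       = refl
shiftT-wk (`S t)   = cong `S (shiftT-wk t)
shiftT-wk (s `+ t) = cong₂ _`+_ (shiftT-wk s) (shiftT-wk t)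
shiftT-wk (s `· t) = cong₂ _`·_ (shiftT-wk s) (shiftT-wk t)

fsubT-shiftT : ∀ {n} σ (t : Tm n) → fsubT σ (shiftT t) ≡ shiftT (fsubT σ t)
fsubT-shiftT σ (fv x)   = sym (shiftT-wk (σ x))
fsubT-shiftT σ (bv i)   = refl
fsubT-shiftT σ `0       = refl
fsubT-shiftT σ (`S t)   = cong `S (fsubT-shiftT σ t)
fsubT-shiftT σ (s `+ t) = cong₂ _`+_ (fsubT-shiftT σ s) (fsubT-shiftT σ t)
fsubT-shiftT σ (s `· t) = cong₂ _`·_ (fsubT-shiftT σ s) (fsubT-shiftT σ t)

fsubT-bsubT : ∀ {m k} σ {τ τ' : Fin m → Tm k} → (∀ i → fsubT σ (τ i) ≡ τ' i) →
              ∀ t → (∀ x → FreeT x t → σ x ≡ fv x) →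
              fsubT σ (bsubT τ t) ≡ bsubT τ' t
fsubT-bsubT σ e (fv x)   f = cong wk (f x refl)
fsubT-bsubT σ e (bv i)   f = e i
fsubT-bsubT σ e `0       f = refl
fsubT-bsubT σ e (`S t)   f = cong `S (fsubT-bsubT σ e t f)
fsubT-bsubT σ e (s `+ t) f =
  cong₂ _`+_ (fsubT-bsubT σ e s λ x → f x ∘ inj₁) (fsubT-bsubT σ e t λ x → f x ∘ inj₂)
fsubT-bsubT σ e (s `· t) f =
  cong₂ _`·_ (fsubT-bsubT σ e s λ x → f x ∘ inj₁) (fsubT-bsubT σ e t λ x → f x ∘ inj₂)

fsubT-liftB : ∀ {m k} σ {τ τ' : Fin m → Tm k} → (∀ i → fsubT σ (τ i) ≡ τ' i) →
              ∀ i → fsubT σ (liftB τ i) ≡ liftB τ' i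
fsubT-liftB σ e zero    = refl
fsubT-liftB σ {τ} e (suc i) = trans (fsubT-shiftT σ (τ i)) (cong shiftT (e i))

fsubF-bsubF : ∀ {m k} σ {τ τ' : Fin m → Tm k} → (∀ i → fsubT σ (τ i) ≡ τ' i) →
              ∀ φ → (∀ x → FreeF x φ → σ x ≡ fv x) →
              fsubF σ (bsubF τ φ) ≡ bsubF τ' φ
fsubF-bsubF σ e (s ≐ t)  f =
  cong₂ _≐_ (fsubT-bsubT σ e s λ x → f x ∘ inj₁) (fsubT-bsubT σ e t λ x → f x ∘ inj₂)
fsubF-bsubF σ e `⊥       f = refl
fsubF-bsubF σ e (φ `∧ ψ) f =
  cong₂ _`∧_ (fsubF-bsubF σ e φ λ x → f x ∘ inj₁) (fsubF-bsubF σ e ψ λ x → f x ∘ inj₂)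
fsubF-bsubF σ e (φ `∨ ψ) f =
  cong₂ _`∨_ (fsubF-bsubF σ e φ λ x → f x ∘ inj₁) (fsubF-bsubF σ e ψ λ x → f x ∘ inj₂)
fsubF-bsubF σ e (φ `→ ψ) f =
  cong₂ _`→_ (fsubF-bsubF σ e φ λ x → f x ∘ inj₁) (fsubF-bsubF σ e ψ λ x → f x ∘ inj₂)
fsubF-bsubF σ e (`∀ φ)   f = cong `∀ (fsubF-bsubF σ (fsubT-liftB σ e) φ f)
fsubF-bsubF σ e (`∃ φ)   f = cong `∃ (fsubF-bsubF σ (fsubT-liftB σ e) φ f)

-- Since `a` is not free in `φ`, it occurs in the instance only where the bound variable stood, so
-- renaming `a` touches nothing else.
fsubF-inst : ∀ {n} (φ : Fm (suc n)) {a} b → ¬ FreeF a φ →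
             fsubF [ fv b / a ] (inst φ (fv a)) ≡ inst φ (fv b)
fsubF-inst φ {a} b a∉φ = fsubF-bsubF [ fv b / a ]
  (λ { zero → cong wk (/-same (fv b) a) ; (suc i) → refl }) φ
  λ x x∈φ → /-other (fv b) λ { refl → a∉φ x∈φ }

FreeT-bsubT : ∀ {m k x} {τ : Fin m → Tm k} t → FreeT x t → FreeT x (bsubT τ t)
FreeT-bsubT (fv y)   p = p
FreeT-bsubT (`S t)   p = FreeT-bsubT t p
FreeT-bsubT (s `+ t) p = map-⊎ (FreeT-bsubT s) (FreeT-bsubT t) p
FreeT-bsubT (s `· t) p = map-⊎ (FreeT-bsubT s) (FreeT-bsubT t) p

-- Only bound variables are replaced. Hence passing from a quantified formula to an instance keeps
-- the stack well-formed.
FreeF-bsubF : ∀ {m k x} {τ : Fin m → Tm k} φ → FreeF x φ → FreeF x (bsubF τ φ)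
FreeF-bsubF (s ≐ t)  p = map-⊎ (FreeT-bsubT s) (FreeT-bsubT t) p
FreeF-bsubF (φ `∧ ψ) p = map-⊎ (FreeF-bsubF φ) (FreeF-bsubF ψ) p
FreeF-bsubF (φ `∨ ψ) p = map-⊎ (FreeF-bsubF φ) (FreeF-bsubF ψ) p
FreeF-bsubF (φ `→ ψ) p = map-⊎ (FreeF-bsubF φ) (FreeF-bsubF ψ) p
FreeF-bsubF (`∀ φ)   p = FreeF-bsubF φ p
FreeF-bsubF (`∃ φ)   p = FreeF-bsubF φ p

∉-fsubT-0 : ∀ {n} x (t : Tm n) → ¬ FreeT x (fsubT [ `0 / x ] t)
∉-fsubT-0 x (fv y) p with y ≟ x
... | yes refl = subst (λ u → FreeT x (wk u)) (/-same `0 x) p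
... | no y≢x   = y≢x (sym (subst (λ u → FreeT x (wk u)) (/-other `0 y≢x) p))
∉-fsubT-0 x (`S t)   p = ∉-fsubT-0 x t p
∉-fsubT-0 x (s `+ t) p = [ ∉-fsubT-0 x s , ∉-fsubT-0 x t ]′ p
∉-fsubT-0 x (s `· t) p = [ ∉-fsubT-0 x s , ∉-fsubT-0 x t ]′ p

∉-fsubF-0 : ∀ {n} x (φ : Fm n) → ¬ FreeF x (fsubF [ `0 / x ] φ)
∉-fsubF-0 x (s ≐ t)  p = [ ∉-fsubT-0 x s , ∉-fsubT-0 x t ]′ p
∉-fsubF-0 x (φ `∧ ψ) p = [ ∉-fsubF-0 x φ , ∉-fsubF-0 x ψ ]′ p
∉-fsubF-0 x (φ `∨ ψ) p = [ ∉-fsubF-0 x φ , ∉-fsubF-0 x ψ ]′ p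
∉-fsubF-0 x (φ `→ ψ) p = [ ∉-fsubF-0 x φ , ∉-fsubF-0 x ψ ]′ p
∉-fsubF-0 x (`∀ φ)   p = ∉-fsubF-0 x φ p
∉-fsubF-0 x (`∃ φ)   p = ∉-fsubF-0 x φ p

-- Excludes the first premise of `case` from any set of nodes in which `x` is free throughout.
∉-case0 : ∀ x s → NotFreeS x (case0 x s)
∉-case0 x (Γ ⇒ δ) (inj₁ p) = All.All¬⇒¬Any (All.map⁺ (All.tabulate λ {φ} _ → ∉-fsubF-0 x φ)) p
∉-case0 x (Γ ⇒ δ) (inj₂ p) = ∉-fsubF-0 x δ p

-- Derived rules of SHA

≈-refl : ∀ {s} → s ≈ s
≈-refl = (λ _ → id) , (λ _ → id) , refl

≈-sym : ∀ {s s'} → s ≈ s' → s' ≈ s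
≈-sym (f , g , e) = g , f , sym e

FreeS-≈ : ∀ {x s s'} → s ≈ s' → FreeS x s → FreeS x s'
FreeS-≈ (f , _ , _) (inj₁ p) with find p
... | φ , φ∈Γ , q = inj₁ (lose (f φ φ∈Γ) q)
FreeS-≈ (_ , _ , refl) (inj₂ p) = inj₂ p

WF-mono : ∀ {Λ} s s' → (∀ {x} → FreeS x s → FreeS x s') → WF Λ s → WF Λ s'
WF-mono s s' f = All.map f

WF-≈ : ∀ {Λ} s s' → s ≈ s' → WF Λ s → WF Λ s'
WF-≈ s s' eq = WF-mono s s' (FreeS-≈ {s = s} {s'} eq)

-- A formula already present may be weakened in, so wkn changes the representative of a context.
repr : ∀ {Λ s s'} → s ≈ s' → WF Λ s → SHA⊢ Λ ∣ s → SHA⊢ Λ ∣ s'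
repr {s = [] ⇒ δ} {[] ⇒ .δ} (_ , _ , refl) wf d = d
repr {s = [] ⇒ δ} {φ ∷ Γ ⇒ _} (_ , g , _) wf d with g φ (here refl)
... | ()
repr {s = φ ∷ Γ ⇒ δ} eq@(f , g , refl) wf d =
  logic (_ , _ , wkn (φ ∷ Γ) φ δ , ≈-refl ∷ [] ,
         (λ ψ → there ∘ g ψ) ,
         (λ { ψ (here e) → f ψ (here e) ; ψ (there m) → f ψ m }) , refl)
        (WF-≈ _ _ eq wf) (d ∷ [])

-- `pop` may conclude an ill-formed sequent, to which `wkn` does not apply. The conversion is
-- therefore moved above every `pop`, up to a rule that guarantees well-formedness.
conv : ∀ {Λ s s'} → s ≈ s' → SHA⊢ Λ ∣ s → SHA⊢ Λ ∣ s'
conv eq (pop Λ' d)           = pop Λ' (conv eq d)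
conv eq d@(logic _ wf _)     = repr eq wf d
conv eq d@(axiom _ _)        = repr eq [] d
conv eq d@(comp _ _ wf _)    = repr eq wf d
conv eq d@(bud _ _ _ wf)     = repr eq wf d
conv eq d@(case _ wf _ _)    = repr eq wf d

rule : ∀ {Λ ss s} → LRule (λ a → ¬ OccursΛ a Λ) ss s → WF Λ s → All (SHA⊢_∣_ Λ) ss → SHA⊢ Λ ∣ s
rule r = logic (_ , _ , r , Pointwise.refl ≈-refl , ≈-refl)

-- =L carries no condition on Λ: cutting its equation b = b against =R substitutes in any stack.
rename : ∀ {Λ s a b} → a ≢ b → WF Λ (subS [ fv b / a ] s) →
         SHA⊢ Λ ∣ s → SHA⊢ Λ ∣ subS [ fv b / a ] s
rename {Λ} {s} {a} {b} a≢b wf d with bounded-⊎ (bounded-≡ a) (bounded-⊎ (bounded-≡ b) (boundedS s))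
... | y , bd = rule (cut _ (fv b ≐ fv b) _) wf
    -- With the succedent replaced, variables of `Λ` may no longer be free, so =R is derived on the
    -- empty stack and followed by `pop`.
    (pop Λ (rule (=R _ (fv b)) [] []) ∷
     subst (λ u → SHA⊢ Λ ∣ ((fv b ≐ fv b) ∷ ctx u ⇒ succ u)) conclusion
       (rule (=L (ctx s) (succ s) a y (fv b) (fv b) (<⇒≢ (bd a (inj₁ refl))) a≢b a≢b y≢b y≢b)
         (subst (λ u → WF Λ ((fv b ≐ fv b) ∷ ctx u ⇒ succ u)) (sym conclusion)
           (WF-mono u ((fv b ≐ fv b) ∷ ctx u ⇒ succ u) [ inj₁ ∘ there , inj₂ ]′ wf))
         (subst (SHA⊢ Λ ∣_) (sym premise) d ∷ [])) ∷ [])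
  where
  u = subS [ fv b / a ] s

  fresh : ∀ {x} → FreeS x s → x ≢ y
  fresh p = <⇒≢ (bd _ (inj₂ (inj₂ p)))

  y≢b : y ≢ b
  y≢b e = <⇒≢ (bd b (inj₂ (inj₁ refl))) (sym e)

  premise : subS [ fv a / y ] s ≡ s
  premise = subS-fixed s λ x p → /-other (fv a) (fresh p)

  conclusion : subS [ fv b / a , fv b / y ] s ≡ subS [ fv b / a ] s
  conclusion = subS-cong s λ x p → //-other (fv b) (fv b) (fresh p)

fresh-for : ∀ Λ s → ∃ λ b → ¬ OccursΛ b Λ × NotFreeS b s
fresh-for Λ s with bounded-⊎ (boundedΛ Λ) (boundedS s)
... | b , bd = b , (λ p → <-irrefl refl (bd b (inj₁ p))) , λ p → <-irrefl refl (bd b (inj₂ p))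

∉⇒map-fixed : ∀ {a} u (Γ : Ctx) → ¬ Any (FreeF a) Γ → map (fsubF [ u / a ]) Γ ≡ Γ
∉⇒map-fixed u Γ a∉Γ =
  cong ctx (subS-fixed (Γ ⇒ `⊥) λ { x (inj₁ p) → /-other u λ { refl → a∉Γ p } })

∉⇒fixed : ∀ {a} u (φ : Fm 0) → ¬ FreeF a φ → fsubF [ u / a ] φ ≡ φ
∉⇒fixed u φ a∉φ =
  cong succ (subS-fixed ([] ⇒ φ) λ { x (inj₂ p) → /-other u λ { refl → a∉φ p } })

-- In CHA an eigenvariable may occur in Λ; it is renamed to one that does not.
∀R′ : ∀ {Λ} Γ φ a → NotFreeS a (Γ ⇒ `∀ φ) → WF Λ (Γ ⇒ `∀ φ) →
      SHA⊢ Λ ∣ (Γ ⇒ inst φ (fv a)) → SHA⊢ Λ ∣ (Γ ⇒ `∀ φ)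
-- `a` is not free in the sequent, so it is the added equation that makes `b` differ from `a`.
∀R′ {Λ} Γ φ a a∉ wf d with fresh-for Λ ((fv a ≐ fv a) ∷ Γ ⇒ `∀ φ)
... | b , b∉Λ , b∉ = rule (∀R Γ φ b (b∉ ∘ [ inj₁ ∘ there , inj₂ ]′) b∉Λ) wf
  (subst (SHA⊢ Λ ∣_) eq (rename a≢b (subst (WF Λ) (sym eq) wf′) d) ∷ [])
  where
  a≢b : a ≢ b
  a≢b e = b∉ (inj₁ (here (inj₁ (sym e))))

  eq : subS [ fv b / a ] (Γ ⇒ inst φ (fv a)) ≡ (Γ ⇒ inst φ (fv b))
  eq = cong₂ _⇒_ (∉⇒map-fixed (fv b) Γ (a∉ ∘ inj₁)) (fsubF-inst φ b (a∉ ∘ inj₂))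

  wf′ : WF Λ (Γ ⇒ inst φ (fv b))
  wf′ = WF-mono (Γ ⇒ `∀ φ) (Γ ⇒ inst φ (fv b)) (map-⊎ id (FreeF-bsubF φ)) wf

∃L′ : ∀ {Λ} Γ φ a δ → NotFreeS a (`∃ φ ∷ Γ ⇒ δ) → WF Λ (`∃ φ ∷ Γ ⇒ δ) →
      SHA⊢ Λ ∣ (inst φ (fv a) ∷ Γ ⇒ δ) → SHA⊢ Λ ∣ (`∃ φ ∷ Γ ⇒ δ)
∃L′ {Λ} Γ φ a δ a∉ wf d with fresh-for Λ ((fv a ≐ fv a) ∷ `∃ φ ∷ Γ ⇒ δ)
... | b , b∉Λ , b∉ = rule (∃L Γ φ b δ (b∉ ∘ [ inj₁ ∘ there , inj₂ ]′) b∉Λ) wf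
  (subst (SHA⊢ Λ ∣_) eq (rename a≢b (subst (WF Λ) (sym eq) wf′) d) ∷ [])
  where
  a≢b : a ≢ b
  a≢b e = b∉ (inj₁ (here (inj₁ (sym e))))

  eq : subS [ fv b / a ] (inst φ (fv a) ∷ Γ ⇒ δ) ≡ (inst φ (fv b) ∷ Γ ⇒ δ)
  eq = cong₂ _⇒_
    (cong₂ _∷_ (fsubF-inst φ b (a∉ ∘ inj₁ ∘ here)) (∉⇒map-fixed (fv b) Γ (a∉ ∘ inj₁ ∘ there)))
    (∉⇒fixed (fv b) δ (a∉ ∘ inj₂))

  wf′ : WF Λ (inst φ (fv b) ∷ Γ ⇒ δ)
  wf′ = WF-mono (`∃ φ ∷ Γ ⇒ δ) (inst φ (fv b) ∷ Γ ⇒ δ)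
    (λ { (inj₁ (here p))  → inj₁ (here (FreeF-bsubF φ p))
       ; (inj₁ (there p)) → inj₁ (there p)
       ; (inj₂ p)         → inj₂ p }) wf

-- Translation of the rules of CHA

convs : ∀ {Λ ss ss'} → Pointwise _≈_ ss ss' → All (SHA⊢_∣_ Λ) ss → All (SHA⊢_∣_ Λ) ss'
convs []         []       = []
convs (eq ∷ eqs) (d ∷ ds) = conv eq d ∷ convs eqs ds

-- Only ∀R and ∃L depend on the freshness requirement; the other templates carry over as they are.
logic′ : ∀ {Λ ss s} → LRule (λ _ → ⊤) ss s → WF Λ s → All (SHA⊢_∣_ Λ) ss → SHA⊢ Λ ∣ s
logic′ (→L Γ φ ψ δ)  wf ds       = rule (→L Γ φ ψ δ) wf ds
logic′ (→R Γ φ ψ)    wf ds       = rule (→R Γ φ ψ) wf ds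
logic′ (∧L Γ φ ψ δ)  wf ds       = rule (∧L Γ φ ψ δ) wf ds
logic′ (∧R Γ φ ψ)    wf ds       = rule (∧R Γ φ ψ) wf ds
logic′ (∨L Γ φ ψ δ)  wf ds       = rule (∨L Γ φ ψ δ) wf ds
logic′ (∨R₁ Γ φ ψ)   wf ds       = rule (∨R₁ Γ φ ψ) wf ds
logic′ (∨R₂ Γ φ ψ)   wf ds       = rule (∨R₂ Γ φ ψ) wf ds
logic′ (∀L Γ φ t δ)  wf ds       = rule (∀L Γ φ t δ) wf ds
logic′ (∀R Γ φ a n _) wf (d ∷ []) = ∀R′ Γ φ a n wf d
logic′ (∃L Γ φ a δ n _) wf (d ∷ []) = ∃L′ Γ φ a δ n wf d
logic′ (∃R Γ φ t)    wf ds       = rule (∃R Γ φ t) wf ds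
logic′ (⊥L Γ δ)      wf ds       = rule (⊥L Γ δ) wf ds
logic′ (=L Γ δ x y s t x≢y xs xt ys yt) wf ds = rule (=L Γ δ x y s t x≢y xs xt ys yt) wf ds
logic′ (=R Γ t)      wf ds       = rule (=R Γ t) wf ds
logic′ (wkn Γ φ δ)   wf ds       = rule (wkn Γ φ δ) wf ds
logic′ (cut Γ φ δ)   wf ds       = rule (cut Γ φ δ) wf ds

AxCHA⇒AxCtx : ∀ {s} → AxCHA s → AxCtx s
AxCHA⇒AxCtx (ax Γ δ)    = ax Γ δ
AxCHA⇒AxCtx (zS t)      = zS [] t
AxCHA⇒AxCtx (SS s t)    = SS [] s t
AxCHA⇒AxCtx (plus0 s)   = plus0 [] s
AxCHA⇒AxCtx (plusS s t) = plusS [] s t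
AxCHA⇒AxCtx (mul0 s)    = mul0 [] s
AxCHA⇒AxCtx (mulS s t)  = mulS [] s t

bump : Maybe ℕ → Stack → Stack
bump nothing  Λ = Λ
bump (just x) Λ = Λ ⁺ x

-- The variable raised on the way to the i-th premise: only the second premise of Case raises one.
edgeVar : ∀ {ss s} → CHAInst ss s → ℕ → Maybe ℕ
edgeVar r 1 = caseVar r
edgeVar r _ = nothing

edgeVar-nothing : ∀ {ss s} (r : CHAInst ss s) → caseVar r ≡ nothing → ∀ i → edgeVar r i ≡ nothing
edgeVar-nothing r e 0             = refl
edgeVar-nothing r e 1             = e
edgeVar-nothing r e (suc (suc _)) = refl

All-lookup⁻ : ∀ {A : Set} {P : A → Set} as → (∀ i → P (lookup as i)) → All P as
All-lookup⁻ []       f = []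
All-lookup⁻ (a ∷ as) f = f zero ∷ All-lookup⁻ as (f ∘ suc)

-- The premises carry the stacks that SHA prescribes, unchanged except at the second premise of
-- `case`. An axiom needs the empty stack, hence the `pop`.
simulate : ∀ {Λ ss s} (r : CHAInst ss s) → WF Λ s →
           (∀ i → SHA⊢ bump (edgeVar r (toℕ i)) Λ ∣ lookup ss i) → SHA⊢ Λ ∣ s
simulate {Λ} {ss} {s} r@(_ , s' , logic l , eqs , eq) wf ds =
  conv (≈-sym eq) (logic′ l (WF-≈ s s' eq wf)
    (convs eqs (All-lookup⁻ ss λ i →
      subst (λ o → SHA⊢ bump o Λ ∣ lookup ss i) (edgeVar-nothing r refl (toℕ i)) (ds i))))
simulate {Λ} (_ , _ , axiom a , _ , eq) wf ds = pop Λ (axiom (AxCHA⇒AxCtx a) eq)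
simulate {s = s} (_ , s' , case x _ , e₀ ∷ e₁ ∷ [] , eq) wf ds =
  conv (≈-sym eq) (case x (WF-≈ s s' eq wf) (conv e₀ (ds zero)) (conv e₁ (ds (suc zero))))

-- Unfolding a finite graph

module Reachability {V : Set} (E : V → V → Set) where

  -- Warshall's recursion: nonempty walks whose inner vertices lie in U.
  Reach : List V → V → V → Set
  Reach []      v w = E v w
  Reach (u ∷ U) v w = Reach U v w ⊎ (Reach U v u × Reach U u w)

  reach? : (∀ v w → Dec (E v w)) → ∀ U v w → Dec (Reach U v w)
  reach? E? []      v w = E? v w
  reach? E? (u ∷ U) v w = reach? E? U v w ⊎-dec (reach? E? U v u ×-dec reach? E? U u w)

  edge⇒reach : ∀ U {v w} → E v w → Reach U v w
  edge⇒reach []      e = e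
  edge⇒reach (u ∷ U) e = inj₁ (edge⇒reach U e)

  -- If `u` is the head, cut the first walk at its first visit to `u` and the second at its last. If
  -- `u` comes later and both walks pass the head `h`, the detour from `h` through `u` back to `h`
  -- is dropped.
  reach-trans : ∀ U {u v w} → u ∈ U → Reach U v u → Reach U u w → Reach U v w
  reach-trans (h ∷ U) (here refl) p q =
    inj₂ ([ id , proj₁ ]′ p , [ id , proj₂ ]′ q)
  reach-trans (h ∷ U) (there m) (inj₁ p)       (inj₁ q)       = inj₁ (reach-trans U m p q)
  reach-trans (h ∷ U) (there m) (inj₁ p)       (inj₂ (q , r)) = inj₂ (reach-trans U m p q , r)
  reach-trans (h ∷ U) (there m) (inj₂ (p , q)) (inj₁ r)       = inj₂ (p , reach-trans U m q r)
  reach-trans (h ∷ U) (there m) (inj₂ (p , _)) (inj₂ (_ , r)) = inj₂ (p , r)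

  -- Nonempty walks all of whose vertices, except possibly the last, lie in S.
  data Walk (S : List V) : V → V → Set where
    last : ∀ {u w} → u ∈ S → E u w → Walk S u w
    step : ∀ {u v w} → u ∈ S → E u v → Walk S v w → Walk S u w

  module _ {S : List V} where

    _++ʷ_ : ∀ {u v w} → Walk S u v → Walk S v w → Walk S u w
    last m e   ++ʷ q = step m e q
    step m e p ++ʷ q = step m e (p ++ʷ q)

    reach⇒walk : ∀ U {u w} → (∀ {v} → v ∈ U → v ∈ S) → u ∈ S → Reach U u w → Walk S u w
    reach⇒walk []      U⊆S m e = last m e
    reach⇒walk (h ∷ U) U⊆S m (inj₁ p) = reach⇒walk U (U⊆S ∘ there) m p
    reach⇒walk (h ∷ U) U⊆S m (inj₂ (p , q)) =
      reach⇒walk U (U⊆S ∘ there) m p ++ʷ reach⇒walk U (U⊆S ∘ there) (U⊆S (here refl)) q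

    size : ∀ {u w} → Walk S u w → ℕ
    size (last _ _)   = 1
    size (step _ _ p) = suc (size p)

    1≤size : ∀ {u w} (p : Walk S u w) → 1 ≤ size p
    1≤size (last _ _)   = s≤s z≤n
    1≤size (step _ _ p) = s≤s z≤n

    module _ {v₀ : V} (loop : Walk S v₀ v₀) where

      -- The infinite walk that follows p and then goes round the loop forever.
      at : ∀ {u} → Walk S u v₀ → ℕ → V
      at {u} p          zero    = u
      at (last _ _)     (suc k) = at loop k
      at (step _ _ p)   (suc k) = at p k

      at-step : ∀ {u} (p : Walk S u v₀) k → E (at p k) (at p (suc k))
      at-step (last _ e)               zero    = e
      at-step (step _ e p)             zero    = e
      at-step (last _ _)               (suc k) = at-step loop k
      at-step (step _ _ p)             (suc k) = at-step p k

      at-∈ : ∀ {u} (p : Walk S u v₀) k → at p k ∈ S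
      at-∈ (last m _)   zero    = m
      at-∈ (step m _ _) zero    = m
      at-∈ (last _ _)   (suc k) = at-∈ loop k
      at-∈ (step _ _ p) (suc k) = at-∈ p k

      -- After `size p` steps `p` is used up and the loop begins; for `p` the loop itself this is
      -- periodicity.
      at-size : ∀ {u} (p : Walk S u v₀) k → at p (size p + k) ≡ at loop k
      at-size (last _ _)   k = refl
      at-size (step _ _ p) k = at-size p k

    -- The end point is not counted; on a loop it is the start of the next round.
    data Visits (x : V) : ∀ {u w} → Walk S u w → Set where
      first : ∀ {w} (p : Walk S x w) → Visits x p
      later : ∀ {u v w} {m : u ∈ S} {e : E u v} {p : Walk S v w} →
              Visits x p → Visits x (step m e p)

    visits-++ʳ : ∀ {x u v w} (p : Walk S u v) {q : Walk S v w} → Visits x q → Visits x (p ++ʷ q)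
    visits-++ʳ (last _ _)   i = later i
    visits-++ʳ (step _ _ p) i = later (visits-++ʳ p i)

    visits⇒at : ∀ {x v₀ u} (loop : Walk S v₀ v₀) {p : Walk S u v₀} → Visits x p → ∃ λ k → at loop p k ≡ x
    visits⇒at loop (first p) = 0 , refl
    visits⇒at loop (later i) with visits⇒at loop i
    ... | k , e = suc k , e

    -- A round takes at least one step, so adding a round for each unit of `N` leads past `N`.
    recurs : ∀ {x v₀} (loop : Walk S v₀ v₀) → Visits x loop →
             ∀ N → ∃ λ k → N ≤ k × at loop loop k ≡ x
    recurs loop i zero    with visits⇒at loop i
    ... | k , e = k , z≤n , e
    recurs loop i (suc N) with recurs loop i N
    ... | k , N≤k , e = size loop + k , +-mono-≤ (1≤size loop) N≤k , trans (at-size loop loop k) e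

    -- Each vertex of `L` contributes a detour from `v₀` to it and back, placed in front of the loop
    -- for the rest.
    loop-through : ∀ {v₀} → v₀ ∈ S → (∀ {u w} → u ∈ S → w ∈ S → Walk S u w) →
                   ∀ L → (∀ {u} → u ∈ L → u ∈ S) →
                   Σ (Walk S v₀ v₀) λ p → ∀ {u} → u ∈ L → Visits u p
    loop-through m conn [] L⊆S = conn m m , λ ()
    loop-through m conn (x ∷ L) L⊆S with loop-through m conn L (L⊆S ∘ there)
    ... | p , vis = there-p ++ʷ (back-p ++ʷ p) , λ
        -- `x` is visited as the start of the way back.
        { (here refl) → visits-++ʳ there-p (first _)
        ; (there i)   → visits-++ʳ there-p (visits-++ʳ back-p (vis i)) }
      where
      there-p = conn m (L⊆S (here refl))
      back-p  = conn (L⊆S (here refl)) m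

-- Stacks under repeated raising

raises : List ℕ → Stack → Stack
raises []       Λ = Λ
raises (x ∷ xs) Λ = raises xs (Λ ⁺ x)

raises-++ : ∀ xs Λ M → raises xs (Λ ++ M) ≡ raises xs Λ ++ raises xs M
raises-++ []       Λ M = refl
raises-++ (x ∷ xs) Λ M = trans (cong (raises xs) (map-++ (raise x) Λ M)) (raises-++ xs (Λ ⁺ x) (M ⁺ x))

raises-∘ : ∀ xs ys Λ → raises ys (raises xs Λ) ≡ raises (xs ++ ys) Λ
raises-∘ []       ys Λ = refl
raises-∘ (x ∷ xs) ys Λ = raises-∘ xs ys (Λ ⁺ x)

var-raise : ∀ x l → var (raise x l) ≡ var l
var-raise x (lab plus y s) = refl
var-raise x (lab minus y s) with does (y ℕ.≟ x)
... | true  = refl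
... | false = refl

WF-raises : ∀ xs {Λ} s → WF Λ s → WF (raises xs Λ) s
WF-raises []       s wf = wf
WF-raises (x ∷ xs) s wf =
  WF-raises xs s (All.map⁺ (All.map (λ {l} → subst (λ y → FreeS y s) (sym (var-raise x l))) wf))

-- `derive` makes the edges out of a vertex the premises of an SHA derivation. By `case-edge`, every
-- edge from a Case_x vertex to a sequent that still contains `x` raises `x`.
module Unfolding
  {V : Set} (_≟ᵛ_ : DecidableEquality V)
  (seq : V → Seq) (succs : V → List (Maybe ℕ × V)) (caseOf : V → Maybe ℕ)
  (derive : ∀ {v Λ} → WF Λ (seq v) →
            (∀ {o w} → (o , w) ∈ succs v → SHA⊢ bump o Λ ∣ seq w) → SHA⊢ Λ ∣ seq v)
  (case-edge : ∀ {v x o w} → caseOf v ≡ just x → (o , w) ∈ succs v → FreeS x (seq w) → o ≡ just x)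
  where

  open DecMembership _≟ᵛ_ using (_∈?_)

  _⟶_ : V → V → Set
  v ⟶ w = w ∈ map proj₂ (succs v)

  _⟶?_ : ∀ v w → Dec (v ⟶ w)
  v ⟶? w = w ∈? map proj₂ (succs v)

  open Reachability _⟶_

  -- The form in which the condition on infinite branches enters: as a property of strongly
  -- connected sets of vertices.
  Progress : Set
  Progress = ∀ {S v} → v ∈ S → (∀ {u w} → u ∈ S → w ∈ S → Walk S u w) →
    Σ ℕ λ x → (∀ {u} → u ∈ S → FreeS x (seq u)) × Σ V λ c → c ∈ S × caseOf c ≡ just x

  -- By the time a vertex is reached, instances of `case` passed on the way may have raised labels
  -- of `Λ`, so all raised versions of `Λ` are demanded at once.
  Derivable : Stack → V → Set
  Derivable Λ v = ∀ xs → SHA⊢ raises xs Λ ∣ seq v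

  -- The invariant of the recursion on `S`: whatever lies one edge outside `S` has been dealt with.
  record Admissible (S : List V) (Λ : Stack) : Set where
    field
      wf   : ∀ {v} → v ∈ S → WF Λ (seq v)
      exit : ∀ {v o w} → v ∈ S → (o , w) ∈ succs v → w ∉ S → Derivable Λ w
  open Admissible

  Solved : List V → Set
  Solved S = ∀ {Λ} → Admissible S Λ → ∀ {v} → v ∈ S → SHA⊢ Λ ∣ seq v

  derivable-raises : ∀ xs {Λ v} → Derivable Λ v → Derivable (raises xs Λ) v
  derivable-raises xs {Λ} {v} d ys = subst (SHA⊢_∣ seq v) (sym (raises-∘ xs ys Λ)) (d (xs ++ ys))

  derivable-bump : ∀ o {Λ v} → Derivable Λ v → SHA⊢ bump o Λ ∣ seq v
  derivable-bump nothing  d = d []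
  derivable-bump (just x) d = d (x ∷ [])

  derivable-pop : ∀ {Λ v} M → Derivable Λ v → Derivable (Λ ++ M) v
  derivable-pop {Λ} {v} M d xs =
    subst (SHA⊢_∣ seq v) (sym (raises-++ xs Λ M)) (pop (raises xs M) (d xs))

  admissible-raises : ∀ xs {S Λ} → Admissible S Λ → Admissible S (raises xs Λ)
  admissible-raises xs ok .wf {v} m     = WF-raises xs (seq v) (ok .wf m)
  admissible-raises xs ok .exit m e w∉S = derivable-raises xs (ok .exit m e w∉S)

  solved⇒derivable : ∀ {S Λ} → Solved S → Admissible S Λ → ∀ {v} → v ∈ S → Derivable Λ v
  solved⇒derivable sol ok m xs = sol (admissible-raises xs ok) m

  derive-all : ∀ {Λ v} → WF Λ (seq v) → (∀ {o w} → (o , w) ∈ succs v → Derivable Λ w) → Derivable Λ v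
  derive-all {v = v} wfv ds xs =
    derive (WF-raises xs (seq v) wfv) λ {o} e → derivable-bump o (derivable-raises xs (ds e))

  -- If w is not reachable from v inside S, then the part of S reachable from v, then v itself,
  -- and then the rest of S can be treated in turn.
  module Split (S : List V) {v w : V} (v∈S : v ∈ S) (w∈S : w ∈ S) (v↛w : ¬ Reach S v w) where

    reachable? = reach? _⟶?_ S v
    R = filter reachable? S

    done? = λ u → (u ≟ᵛ v) ⊎-dec reachable? u
    Q = filter (¬? ∘ done?) S

    R-shorter : length R < length S
    R-shorter = filter-notAll reachable? S (lose w∈S v↛w)

    Q-shorter : length Q < length S
    Q-shorter = filter-notAll (¬? ∘ done?) S (lose v∈S λ f → f (inj₁ refl))

    solve : Solved R → Solved Q → Solved S
    solve solR solQ {Λ} ok = all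
      where
      okR : Admissible R Λ
      okR .wf m = ok .wf (proj₁ (∈-filter⁻ reachable? m))
      okR .exit {o = o} {w'} m e w'∉R with ∈-filter⁻ reachable? m
      -- `R` is closed under edges inside `S`, so an edge that leaves `R` leaves `S`.
      ... | u∈S , v→u = ok .exit u∈S e λ w'∈S →
        w'∉R (∈-filter⁺ reachable? w'∈S (reach-trans S u∈S v→u (edge⇒reach S (∈-map⁺ proj₂ e))))

      inside : ∀ {u} → u ∈ S → Reach S v u → Derivable Λ u
      inside u∈S v→u = solved⇒derivable solR okR (∈-filter⁺ reachable? u∈S v→u)

      source : Derivable Λ v
      source = derive-all (ok .wf v∈S) λ {o} {u} e → target e
        where
        target : ∀ {o u} → (o , u) ∈ succs v → Derivable Λ u
        target {u = u} e with u ∈? S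
        ... | yes u∈S = inside u∈S (edge⇒reach S (∈-map⁺ proj₂ e))
        ... | no  u∉S = ok .exit v∈S e u∉S

      done : ∀ {u} → u ∈ S → u ≡ v ⊎ Reach S v u → Derivable Λ u
      done u∈S (inj₁ refl) = source
      done u∈S (inj₂ v→u)  = inside u∈S v→u

      okQ : Admissible Q Λ
      okQ .wf m = ok .wf (proj₁ (∈-filter⁻ (¬? ∘ done?) m))
      okQ .exit {w = w'} m e w'∉Q with w' ∈? S
      ... | no w'∉S = ok .exit (proj₁ (∈-filter⁻ (¬? ∘ done?) m)) e w'∉S
      ... | yes w'∈S with done? w'
      ...   | yes d = done w'∈S d
      ...   | no ¬d = contradiction (∈-filter⁺ (¬? ∘ done?) w'∈S ¬d) w'∉Q

      all : ∀ {u} → u ∈ S → SHA⊢ Λ ∣ seq u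
      all {u} u∈S with done? u
      ... | yes d = done u∈S d []
      ... | no ¬d = solQ okQ (∈-filter⁺ (¬? ∘ done?) u∈S ¬d)

  module Component (S : List V) (x : ℕ) (x∈ : ∀ {u} → u ∈ S → FreeS x (seq u))
                   {c : V} (c∈S : c ∈ S) (c-case : caseOf c ≡ just x) where

    case? = λ u → Maybe.≡-dec ℕ._≟_ (caseOf u) (just x)
    P = filter (¬? ∘ case?) S

    P-shorter : length P < length S
    P-shorter = filter-notAll (¬? ∘ case?) S (lose c∈S λ f → f c-case)

    labs : List V → Stack
    labs = map (lab plus x ∘ seq)

    -- Raising only turns minus into plus, so a label once raised stays fixed whatever is passed
    -- later.
    raises-labs : ∀ xs T → raises xs (labs T) ≡ labs T
    raises-labs []       T = refl
    raises-labs (y ∷ xs) T = trans (cong (raises xs) (raise-labs T)) (raises-labs xs T)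
      where
      raise-labs : ∀ T → labs T ⁺ y ≡ labs T
      raise-labs []      = refl
      raise-labs (_ ∷ T) = cong (_ ∷_) (raise-labs T)

    WF-labs : ∀ T {u} → u ∈ S → WF (labs T) (seq u)
    WF-labs T u∈S = All.map⁺ (All.tabulate λ _ → x∈ u∈S)

    raise-minus : ∀ s → raise x (lab minus x s) ≡ lab plus x s
    raise-minus s with does (x ℕ.≟ x) | dec-true (x ℕ.≟ x) refl
    ... | true | refl = refl

    module _ (solP : Solved P) where

      -- T lists the vertices already pushed, all of whose labels have been raised.
      solve : ∀ n U T → length U ≤ n → (∀ {u} → u ∈ S → u ∉ T → u ∈ U) →
              ∀ {Λ} → Admissible S Λ → ∀ {u} → u ∈ S → SHA⊢ Λ ++ labs T ∣ seq u
      solve n U T U≤n cover {Λ} ok {u} u∈S with u ∈? T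
      solve n U T U≤n cover {Λ} ok {u} u∈S | yes u∈T with ∈-∃++ u∈T
      ... | T₁ , T₂ , refl = subst (SHA⊢_∣ seq u) eq
          -- The label of `u` need not be last in the stack; popping the labels after it makes it
          -- so.
          (pop (labs T₂) (bud x (x∈ u∈S) ≈-refl
            (All.∷ʳ⁺ (All.++⁺ (ok .wf u∈S) (WF-labs T₁ u∈S)) (x∈ u∈S))))
        where
        eq : ((Λ ++ labs T₁) ∷ʳ lab plus x (seq u)) ++ labs T₂ ≡ Λ ++ labs (T₁ ++ u ∷ T₂)
        eq = trans (∷ʳ-++ (Λ ++ labs T₁) _ (labs T₂))
               (trans (++-assoc Λ (labs T₁) _)
                 (cong (Λ ++_) (sym (map-++ (lab plus x ∘ seq) T₁ (u ∷ T₂)))))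
      -- `n` bounds the length of `U`, which contains every vertex of `S` not yet pushed, in
      -- particular `u`.
      solve zero [] T _ cover ok u∈S | no u∉T with () ← cover u∈S u∉T
      solve (suc n) U T U≤n cover {Λ} ok {u} u∈S | no u∉T =
          comp x (x∈ u∈S) (All.++⁺ (ok .wf u∈S) (WF-labs T u∈S)) pushed
        where
        l : Label
        l = lab minus x (seq u)

        M : Stack
        M = (Λ ++ labs T) ∷ʳ l

        M-eq : M ≡ Λ ++ (labs T ∷ʳ l)
        M-eq = ++-assoc Λ (labs T) _

        WF-M : ∀ {w} → w ∈ S → WF M (seq w)
        WF-M w∈S = All.∷ʳ⁺ (All.++⁺ (ok .wf w∈S) (WF-labs T w∈S)) (x∈ w∈S)

        U' : List V
        U' = filter (¬? ∘ (_≟ᵛ u)) U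

        U'≤n : length U' ≤ n
        U'≤n = s≤s⁻¹ (≤-trans (filter-notAll (¬? ∘ (_≟ᵛ u)) U (lose (cover u∈S u∉T) λ f → f refl)) U≤n)

        cover' : ∀ {w} → w ∈ S → w ∉ T ∷ʳ u → w ∈ U'
        cover' w∈S w∉ = ∈-filter⁺ (¬? ∘ (_≟ᵛ u)) (cover w∈S (w∉ ∘ ∈-++⁺ˡ))
          λ { refl → w∉ (∈-++⁺ʳ T (here refl)) }

        outside : ∀ {w} → Derivable Λ w → Derivable M w
        outside {w} d = subst (λ N → Derivable N w) (sym M-eq) (derivable-pop (labs T ∷ʳ l) d)

        -- Whatever has been raised since the push of `u`, raising `x` at the end leaves its label
        -- with plus. So `u` joins the pushed vertices, while only the part `Λ` remembers `xs`.
        raised : ∀ xs → raises xs M ⁺ x ≡ raises (xs ∷ʳ x) Λ ++ labs (T ∷ʳ u)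
        raised xs = trans (raises-∘ xs (x ∷ []) M) (trans (cong (raises (xs ∷ʳ x)) M-eq)
          (trans (raises-++ (xs ∷ʳ x) Λ _) (cong (raises (xs ∷ʳ x) Λ ++_) labels)))
          where
          raised-label : ∀ xs → raises (xs ∷ʳ x) (l ∷ []) ≡ lab plus x (seq u) ∷ []
          raised-label []       = cong (_∷ []) (raise-minus (seq u))
          raised-label (y ∷ xs) with does (x ℕ.≟ y)
          ... | true  = raises-labs (xs ∷ʳ x) (u ∷ [])
          ... | false = raised-label xs

          labels : raises (xs ∷ʳ x) (labs T ∷ʳ l) ≡ labs (T ∷ʳ u)
          labels = trans (raises-++ (xs ∷ʳ x) (labs T) _)
            (trans (cong₂ _++_ (raises-labs (xs ∷ʳ x) T) (raised-label xs))
              (sym (map-++ (lab plus x ∘ seq) T (u ∷ []))))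

        at-case : ∀ {w} → w ∈ S → caseOf w ≡ just x → Derivable M w
        at-case {w} w∈S cw xs = derive (WF-raises xs (seq w) (WF-M w∈S)) branch
          where
          branch : ∀ {o w'} → (o , w') ∈ succs w → SHA⊢ bump o (raises xs M) ∣ seq w'
          branch {o} {w'} e with w' ∈? S
          ... | no w'∉S = derivable-bump o (derivable-raises xs (outside (ok .exit w∈S e w'∉S)))
          -- `x` is still free at `w'`, so this edge raises `x` and the recursion continues with `u`
          -- pushed.
          ... | yes w'∈S with refl ← case-edge cw e (x∈ w'∈S) =
            subst (SHA⊢_∣ seq w') (sym (raised xs))
              (solve n U' (T ∷ʳ u) U'≤n cover' (admissible-raises (xs ∷ʳ x) ok) w'∈S)

        -- An edge out of `P` either leaves `S` or reaches a Case_x vertex, which `at-case` derives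
        -- with fewer vertices left to push.
        okP : Admissible P M
        okP .wf m = WF-M (proj₁ (∈-filter⁻ (¬? ∘ case?) m))
        okP .exit {w = w} m e w∉P with w ∈? S
        ... | no w∉S = outside (ok .exit (proj₁ (∈-filter⁻ (¬? ∘ case?) m)) e w∉S)
        ... | yes w∈S with case? w
        ...   | yes cw = at-case w∈S cw
        ...   | no ¬cw = contradiction (∈-filter⁺ (¬? ∘ case?) w∈S ¬cw) w∉P

        pushed : SHA⊢ M ∣ seq u
        pushed with case? u
        ... | yes cu = at-case u∈S cu []
        ... | no ¬cu = solP okP (∈-filter⁺ (¬? ∘ case?) u∈S ¬cu)

      solve-all : Solved S
      solve-all {Λ} ok {v} m = subst (SHA⊢_∣ seq v) (++-identityʳ Λ)
        (solve (length S) S [] ≤-refl (λ u∈S _ → u∈S) ok m)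

  -- Induction on the length of `S`: each of `R`, `Q` and `P` is strictly shorter, while the stack
  -- may grow freely.
  solved : Progress → ∀ n S → length S ≤ n → Solved S
  solved prog n       []        S≤n ok ()
  solved prog (suc n) S@(s₀ ∷ _) S≤n
    with all? (λ v → all? (reach? _⟶?_ S v) S) S
  ... | no ¬conn with find (All.¬All⇒Any¬ (λ v → all? (reach? _⟶?_ S v) S) S ¬conn)
  ...   | v , v∈S , ¬r with find (All.¬All⇒Any¬ (reach? _⟶?_ S v) S ¬r)
  ...     | w , w∈S , v↛w =
            solve (solved prog n R (s≤s⁻¹ (≤-trans R-shorter S≤n)))
                  (solved prog n Q (s≤s⁻¹ (≤-trans Q-shorter S≤n)))
    where open Split S v∈S w∈S v↛w
  solved prog (suc n) S@(s₀ ∷ _) S≤n | yes conn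
    with prog {S} (here refl) (λ u∈S w∈S → reach⇒walk S id u∈S (All.lookup (All.lookup conn u∈S) w∈S))
  ... | x , x∈ , c , c∈S , cc = solve-all (solved prog n P (s≤s⁻¹ (≤-trans P-shorter S≤n)))
    where open Component S x x∈ c∈S cc

-- The graph of a pre-proof

-- By `∉-case0` the first premise of Case_x has lost `x`; the second is the one that raises it.
case-premise : ∀ {ss s x} (r : CHAInst ss s) → caseVar r ≡ just x → ∀ i →
               FreeS x (lookup ss i) → edgeVar r (toℕ i) ≡ just x
case-premise (_ , _ , logic _ , _) ()
case-premise (_ , _ , axiom _ , _) ()
case-premise (_ , s , case x _ , e₀ ∷ e₁ ∷ [] , _) refl zero p =
  contradiction (FreeS-≈ e₀ p) (∉-case0 x s)
case-premise (_ , s , case x _ , e₀ ∷ e₁ ∷ [] , _) refl (suc zero) p = refl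

root : ∀ {s} (t : PreTree s) → Σ Info λ j → look t [] ≡ just j × infoSeq j ≡ s
root (bud c)       = _ , refl , refl
root (node ss r f) = _ , refl , refl

look-child : ∀ {s} (t : PreTree s) p {s' ss r} → look t p ≡ just (nodeI s' ss r) →
             ∀ i → Σ Info λ j → look t (p ∷ʳ toℕ i) ≡ just j × infoSeq j ≡ lookup ss i
look-child (node ss r f) [] refl i with toℕ i <? length ss
... | yes h rewrite fromℕ<-toℕ i h = root (f i)
... | no ¬h = contradiction (toℕ<n i) ¬h
look-child (node ss r f) (k ∷ p) e i with k <? length ss
... | yes h = look-child (f (fromℕ< h)) p e i

look-prefix : ∀ {s} (t : PreTree s) p k q {j} → look t (p ++ k ∷ q) ≡ just j →
              Σ Seq λ s' → Σ (List Seq) λ ss → Σ (CHAInst ss s') λ r →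
              look t p ≡ just (nodeI s' ss r) × k < length ss
look-prefix (node ss r f) [] k q e with k <? length ss
... | yes h = _ , _ , _ , refl , h
look-prefix (node ss r f) (l ∷ p) k q e with l <? length ss
... | yes h = look-prefix (f (fromℕ< h)) p k q e

-- Taken at the empty address, it connects the root with any node, since every proper prefix of a
-- valid address is an inner node.
descend : ∀ {s} (t : PreTree s) p q {j} → look t (p ++ q) ≡ just j → Star (Step t) p (p ++ q)
descend t p []      e = subst (Star (Step t) p) (sym (++-identityʳ p)) ε
descend t p (k ∷ q) {j} e with look-prefix t p k q e
... | _ , _ , _ , e' , h = child k e' h ◅
  subst (Star (Step t) (p ∷ʳ k)) eq (descend t (p ∷ʳ k) q (subst (λ a → look t a ≡ just j) (sym eq) e))
  where
  eq : (p ∷ʳ k) ++ q ≡ p ++ k ∷ q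
  eq = ++-assoc p (k ∷ []) q

addrs : ∀ {s} → PreTree s → List Addr
addrs (bud c)       = [] ∷ []
addrs (node ss r f) = [] ∷ concatMap (λ i → map (toℕ i ∷_) (addrs (f i))) (allFin (length ss))

∈-addrs : ∀ {s} (t : PreTree s) p {j} → look t p ≡ just j → p ∈ addrs t
∈-addrs (bud c)       []      e = here refl
∈-addrs (node ss r f) []      e = here refl
∈-addrs (node ss r f) (k ∷ p) e with k <? length ss
... | yes h = there (∈-concatMap⁺ (λ i → map (toℕ i ∷_) (addrs (f i)))
    (lose (∈-allFin (fromℕ< h))
      (subst (λ l → l ∷ p ∈ map (toℕ (fromℕ< h) ∷_) (addrs (f (fromℕ< h)))) (toℕ-fromℕ< h)
      (∈-map⁺ _ (∈-addrs (f (fromℕ< h)) p e)))))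

-- An infinite branch has to start at the root, whereas a loop in a component starts elsewhere. The
-- offset `l` transfers what holds of `g` from some point on to `f`.
prepend : ∀ {A : Set} {R : A → A → Set} {a b} → Star R a b →
          (f : ℕ → A) → f 0 ≡ b → (∀ k → R (f k) (f (suc k))) →
          Σ (ℕ → A) λ g → g 0 ≡ a × (∀ k → R (g k) (g (suc k))) × ∃ λ l → ∀ k → g (l + k) ≡ f k
prepend ε f f0 st = f , f0 , st , 0 , λ _ → refl
prepend {A} {R} {a} (_◅_ {j = c} e es) f f0 st with prepend es f f0 st
... | g , g0 , gst , l , eq = h , refl , hst , suc l , eq
  where
  h : ℕ → A
  h zero    = a
  h (suc k) = g k

  hst : ∀ k → R (h k) (h (suc k))
  hst zero    = subst (R a) (sym g0) e
  hst (suc k) = gst k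

module Tree {s} (t : PreTree s) (pre : IsPreProof t) (good : (b : InfBranch t) → GoodBranch b) where

  -- Invalid addresses get a provable sequent and no successors.
  seqI : Maybe Info → Seq
  seqI nothing  = [] ⇒ (`0 ≐ `0)
  seqI (just j) = infoSeq j

  succsI : Addr → Maybe Info → List (Maybe ℕ × Addr)
  succsI p nothing               = []
  succsI p (just (budI _ c))     = (nothing , c) ∷ []
  succsI p (just (nodeI _ ss r)) = map (λ i → edgeVar r (toℕ i) , p ∷ʳ toℕ i) (allFin (length ss))

  caseI : Maybe Info → Maybe ℕ
  caseI (just (nodeI _ _ r)) = caseVar r
  caseI _                    = nothing

  seq : Addr → Seq
  seq p = seqI (look t p)

  seq-just : ∀ {p j} → look t p ≡ just j → seq p ≡ infoSeq j
  seq-just = cong seqI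

  -- A bud is a vertex of its own, and its edge to the companion becomes a mere conversion. The
  -- result of `look` is a separate argument so that matching on it reduces `seqI` and `succsI`.
  derive : ∀ {p Λ} m → look t p ≡ m → WF Λ (seqI m) →
           (∀ {o w} → (o , w) ∈ succsI p m → SHA⊢ bump o Λ ∣ seq w) → SHA⊢ Λ ∣ seqI m
  derive nothing e wf ds = rule (=R [] `0) wf []
  derive {p} {Λ} (just (budI s' c)) e wf ds with pre p s' c e
  ... | s'' , ss , r , e' , _ , eq = conv eq (subst (SHA⊢ Λ ∣_) (seq-just e') (ds (here refl)))
  derive {p} {Λ} (just (nodeI s' ss r)) e wf ds = simulate r wf λ i →
    let j , e' , eq = look-child t p e i in
    subst (SHA⊢ bump (edgeVar r (toℕ i)) Λ ∣_) (trans (seq-just e') eq) (ds (∈-map⁺ _ (∈-allFin i)))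

  case-edge : ∀ {p x o w} m → look t p ≡ m → caseI m ≡ just x → (o , w) ∈ succsI p m →
              FreeS x (seq w) → o ≡ just x
  case-edge {p} {x} (just (nodeI s' ss r)) e c m fr with ∈-map⁻ _ m
  ... | i , _ , refl with look-child t p e i
  ...   | j , e' , eq = case-premise r c i (subst (FreeS x) (trans (seq-just e') eq) fr)

  edge-valid : ∀ {p o w} m → look t p ≡ m → (o , w) ∈ succsI p m → Σ Info λ j → look t w ≡ just j
  edge-valid {p} (just (budI s' c)) e (here refl) with pre p s' c e
  ... | _ , _ , _ , e' , _ = _ , e'
  edge-valid {p} (just (nodeI s' ss r)) e m with ∈-map⁻ _ m
  ... | i , _ , refl with look-child t p e i
  ...   | j , e' , _ = j , e'

  edge⇒step : ∀ {p o w} m → look t p ≡ m → (o , w) ∈ succsI p m → Step t p w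
  edge⇒step (just (budI s' c)) e (here refl) = jump e
  edge⇒step (just (nodeI s' ss r)) e m with ∈-map⁻ _ m
  ... | i , _ , refl = child (toℕ i) e (toℕ<n i)

  open Unfolding (≡-dec ℕ._≟_) seq (λ p → succsI p (look t p)) (caseI ∘ look t)
    (λ {p} → derive (look t p) refl) (λ {p} → case-edge (look t p) refl)
  open Reachability _⟶_

  ⟶⇒step : ∀ {p w} → p ⟶ w → Step t p w
  ⟶⇒step {p} e with ∈-map⁻ proj₂ e
  ... | _ , m , refl = edge⇒step (look t p) refl m

  step-valid : ∀ {p w} → Step t p w → Σ Info λ j → look t p ≡ just j
  step-valid (child _ e _) = _ , e
  step-valid (jump e)      = _ , e

  source : ∀ {S u w} → Walk S u w → ∃ λ v → u ⟶ v
  source (last _ e)   = _ , e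
  source (step _ e _) = _ , e

  -- A single loop through all of `S`, entered from the root, is an infinite branch; so one and the
  -- same variable serves every vertex of `S`.
  progress : Progress
  progress {S} {v} v∈S conn
    with loop-through v∈S conn S id
       | step-valid (⟶⇒step (proj₂ (source (conn v∈S v∈S))))
  ... | loop , vis | _ , valid
    with prepend (descend t [] v valid) (at loop loop) refl (⟶⇒step ∘ at-step loop loop)
  ... | g , g0 , gst , l , eq
    with good (record { pos = g ; start = g0 ; steps = gst })
  -- Asking for a Case_x node after position `l`, where the entry path ends, ensures that it lies on
  -- the loop and thus in `S`.
  ... | x , N , free , cases = x , always , passes (cases l)
    where
    always : ∀ {u} → u ∈ S → FreeS x (seq u)
    -- Every vertex of `S` recurs beyond `N`, where `x` is known to be free.
    always u∈S with recurs loop (vis u∈S) N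
    ... | k , N≤k , refl with free (l + k) (≤-trans N≤k (m≤n+m k l))
    ...   | j , e , fr = subst (FreeS x)
              (sym (seq-just (subst (λ p → look t p ≡ just j) (eq k) e))) fr

    passes : (Σ ℕ λ k → l ≤ k × CaseAt t x (g k)) → Σ Addr λ c → c ∈ S × caseI (look t c) ≡ just x
    passes (k , l≤k , s' , ss , r , e , cx) =
      g k ,
      subst (_∈ S) (trans (sym (eq (k ∸ l))) (cong g (m+[n∸m]≡n l≤k))) (at-∈ loop loop (k ∸ l)) ,
      trans (cong caseI e) cx

  derivation : SHA⊢ s
  derivation with root t
  ... | j , e , refl = subst (SHA⊢ [] ∣_) (seq-just e)
    -- The set of all addresses is closed under edges, so no exits arise, and the empty stack is
    -- well-formed everywhere.
    (solved progress _ (addrs t) ≤-refl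
      (record { wf   = λ _ → []
              ; exit = λ {p} _ m w∉ → contradiction
                  (∈-addrs t _ (proj₂ (edge-valid (look t p) refl m))) w∉ })
      (∈-addrs t [] e))

theorem3p2 : (Γ : Ctx) (δ : Fm 0) → CHA⊢ (Γ ⇒ δ) → SHA⊢ (Γ ⇒ δ)
theorem3p2 Γ δ (t , pre , good) = Tree.derivation t pre good
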